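{- Let $\Gamma=(G,\sigma)$ be a signed graph and $\mu$ a positive measure on $V$. Then $$h_1^{\sigma}(\mu)=\min_{\emptyset\neq S\subseteq V}\frac{2e^{\sigma}_{\min}(S)+|E(S,\overline{S})|}{\mathrm{vol}_{\mu}(S)}.$$
   Context: A signed graph $\Gamma=(G,\sigma)$ consists of a finite simple undirected graph $G=(V,E)$, positive symmetric edge weights $w_{uv}>0$ for $\{u,v\}\in E$ ($w_{uv}=0$ otherwise), and a signature $\sigma:E\to\{+1,-1\}$. The sign of a cycle is the product of the signs of its edges; a signed graph is balanced if all its cycles are positive. For $S\subseteq V$, let $\Gamma_S$ be the induced signed subgraph on $S$ with edge set $E_S$, and let $e^{\sigma}_{\min}(S)$ be the minimum of $\sum_{\{u,v\}\in E_1}w_{uv}$ over all $E_1\subseteq E_S$ such that $\Gamma_S$ becomes balanced after deleting the edges of $E_1$. For a positive measure $\mu$, $\mathrm{vol}_\mu(S)=\sum_{u\in S}\mu(u)$. For $V_1,V_2\subseteq V$, $|E(V_1,V_2)|=\sum_{u\in V_1}\sum_{v\in V_2}w_{uv}$, $|E^{\pm}(V_1,V_2)|=\sum_{u\in V_1}\sum_{v\in V_2,\sigma(uv)=\pm1}w_{uv}$, $|E^\pm(V_1)|=|E^\pm(V_1,V_1)|$. For disjoint $V_1,V_2$ with $V_1\cup V_2\ne\emptyset$, $$\beta^{\sigma}(V_1,V_2)=\frac{2|E^{+}(V_1,V_2)|+|E^-(V_1)|+|E^-(V_2)|+|E(V_1\cup V_2,\overline{V_1\cup V_2})|}{\mathrm{vol}_{\mu}(V_1\cup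 V_2)},$$ and $h_1^\sigma(\mu)$ is its minimum over all such pairs. -}

module Defs where

open import Level using (0ℓ)
open import Algebra.Bundles using (CommutativeRing)
open import Relation.Binary.Core using (Rel)
open import Relation.Binary.Structures using (IsTotalOrder)
open import Relation.Nullary using (¬_)
open import Relation.Binary.PropositionalEquality using (_≡_)
open import Data.Nat as ℕ using (ℕ; zero; suc)
open import Data.Bool using (Bool; true; false; _∧_; not; if_then_else_)
open import Data.Fin using (Fin; toℕ)
open import Data.Fin.Subset using (Subset; _∪_; ∁)
open import Data.Vec using (lookup)
open import Data.List using (List; []; _∷_; _++_; [_]; length; foldr)
open import Data.List.Relation.Unary.All using (All)
open import Data.List.Relation.Unary.Unique.Propositional using (Unique)
open import Data.Product using (Σ; ∃; _×_; _,_)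
open import Data.Sign as Sign using (Sign)
open import Function.Base using (_∘_)

-- An ordered field (the weights and the measure take values in it; ℝ is an instance).
record OrderedField : Set₁ where
  field
    commutativeRing : CommutativeRing 0ℓ 0ℓ
  open CommutativeRing commutativeRing public
  field
    _≤_          : Rel Carrier 0ℓ
    isTotalOrder : IsTotalOrder _≈_ _≤_
    +-mono-≤     : ∀ {a b} c → a ≤ b → (a + c) ≤ (b + c)
    *-nonneg     : ∀ {a b} → 0# ≤ a → 0# ≤ b → 0# ≤ (a * b)
    0≉1          : ¬ (0# ≈ 1#)
    inverse      : ∀ a → ¬ (a ≈ 0#) → ∃ λ b → (a * b) ≈ 1#

  -- strict positivity
  Pos : Carrier → Set
  Pos a = (0# ≤ a) × ¬ (a ≈ 0#)

module _ (F : OrderedField) where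
  open OrderedField F

  -- A signed graph on vertex set Fin n: simple graph (adjacency), positive
  -- symmetric weights on edges (0 otherwise), and a symmetric signature.
  record SignedGraph (n : ℕ) : Set where
    field
      adj       : Fin n → Fin n → Bool
      adj-sym   : ∀ u v → adj u v ≡ adj v u
      adj-irr   : ∀ u → adj u u ≡ false
      w         : Fin n → Fin n → Carrier
      w-sym     : ∀ u v → w u v ≈ w v u
      w-pos     : ∀ u v → adj u v ≡ true → Pos (w u v)
      w-zero    : ∀ u v → adj u v ≡ false → w u v ≈ 0#
      σ         : Fin n → Fin n → Sign
      σ-sym     : ∀ u v → σ u v ≡ σ v u

  -- sum over Fin n
  ΣF : ∀ {n} → (Fin n → Carrier) → Carrier
  ΣF {zero}  f = 0#
  ΣF {suc n} f = f Fin.zero + ΣF (f ∘ Fin.suc)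

  [_]· : Bool → Carrier → Carrier
  [ b ]· x = if b then x else 0#

  -- consecutive pairs of a list; edges of the closed walk through a vertex list
  consec : ∀ {A : Set} → List A → List (A × A)
  consec (x ∷ y ∷ xs) = (x , y) ∷ consec (y ∷ xs)
  consec _            = []

  cycEdges : ∀ {A : Set} → List A → List (A × A)
  cycEdges []       = []
  cycEdges (x ∷ xs) = consec (x ∷ xs ++ [ x ])

  module _ {n : ℕ} (Γ : SignedGraph n) where
    open SignedGraph Γ

    -- a cycle in the graph with adjacency A: at least 3 distinct vertices,
    -- consecutive ones (cyclically) adjacent
    IsCycle : (Fin n → Fin n → Bool) → List (Fin n) → Set
    IsCycle A vs = (3 ℕ.≤ length vs) × Unique vs
                   × All (λ { (u , v) → A u v ≡ true }) (cycEdges vs)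

    cycleSign : List (Fin n) → Sign
    cycleSign vs = foldr (λ { (u , v) s → σ u v Sign.* s }) Sign.+ (cycEdges vs)

    -- balanced: every cycle is positive
    Balanced : (Fin n → Fin n → Bool) → Set
    Balanced A = ∀ vs → IsCycle A vs → cycleSign vs ≡ Sign.+

    _∋_ : Subset n → Fin n → Bool
    S ∋ u = lookup S u

    -- D ⊆ E_S is a (symmetric) set of edges of Γ_S to be deleted
    Deletable : Subset n → (Fin n → Fin n → Bool) → Set
    Deletable S D = (∀ u v → D u v ≡ D v u)
                  × (∀ u v → D u v ≡ true → (adj u v ≡ true) × (S ∋ u ≡ true) × (S ∋ v ≡ true))

    -- adjacency of Γ_S with the edges D deleted
    remaining : Subset n → (Fin n → Fin n → Bool) → Fin n → Fin n → Bool
    remaining S D u v = adj u v ∧ (S ∋ u) ∧ (S ∋ v) ∧ not (D u v)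

    -- total weight of an edge set (each unordered edge counted once)
    edgeWeight : (Fin n → Fin n → Bool) → Carrier
    edgeWeight D = ΣF λ u → ΣF λ v → [ (toℕ u ℕ.<ᵇ toℕ v) ∧ D u v ]· (w u v)

    -- e is e^σ_min(S)
    IsEmin : Subset n → Carrier → Set
    IsEmin S e = (∃ λ D → Deletable S D × Balanced (remaining S D) × (edgeWeight D ≈ e))
               × (∀ D → Deletable S D → Balanced (remaining S D) → e ≤ edgeWeight D)

    vol : (Fin n → Carrier) → Subset n → Carrier
    vol μ S = ΣF λ u → [ S ∋ u ]· (μ u)

    -- |E(V1,V2)| and |E^±(V1,V2)| (ordered double sums)
    Ew : Subset n → Subset n → Carrier
    Ew V₁ V₂ = ΣF λ u → ΣF λ v → [ (V₁ ∋ u) ∧ (V₂ ∋ v) ]· (w u v)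

    isSign : Sign → Sign → Bool
    isSign Sign.+ Sign.+ = true
    isSign Sign.- Sign.- = true
    isSign _      _      = false

    Es : Sign → Subset n → Subset n → Carrier
    Es s V₁ V₂ = ΣF λ u → ΣF λ v → [ (V₁ ∋ u) ∧ (V₂ ∋ v) ∧ isSign s (σ u v) ]· (w u v)

    Disjoint : Subset n → Subset n → Set
    Disjoint V₁ V₂ = ∀ u → (V₁ ∋ u) ∧ (V₂ ∋ u) ≡ false

    NonEmpty : Subset n → Set
    NonEmpty S = ∃ λ u → S ∋ u ≡ true

    -- numerator of β^σ(V1,V2)
    βnum : Subset n → Subset n → Carrier
    βnum V₁ V₂ = ((Es Sign.+ V₁ V₂ + Es Sign.+ V₁ V₂) + Es Sign.- V₁ V₁ + Es Sign.- V₂ V₂)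
                 + Ew (V₁ ∪ V₂) (∁ (V₁ ∪ V₂))

    -- m = h₁^σ(μ) = min β^σ(V1,V2)  (m = a/b written as m·b = a, b > 0)
    IsH1 : (Fin n → Carrier) → Carrier → Set
    IsH1 μ m =
        (∃ λ V₁ → ∃ λ V₂ → Disjoint V₁ V₂ × NonEmpty (V₁ ∪ V₂)
                    × ((m * vol μ (V₁ ∪ V₂)) ≈ βnum V₁ V₂))
      × (∀ V₁ V₂ → Disjoint V₁ V₂ → NonEmpty (V₁ ∪ V₂)
                    → (m * vol μ (V₁ ∪ V₂)) ≤ βnum V₁ V₂)

    -- m = min over nonempty S of (2 e_min(S) + |E(S, S̄)|) / vol(S)
    IsRHS : (Fin n → Carrier) → Carrier → Set
    IsRHS μ m =
        (∃ λ S → ∃ λ e → NonEmpty S × IsEmin S e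
                    × ((m * vol μ S) ≈ ((e + e) + Ew S (∁ S))))
      × (∀ S e → NonEmpty S → IsEmin S e
                    → (m * vol μ S) ≤ ((e + e) + Ew S (∁ S)))

module Submission where

-- Corollary 3.4:  h₁^σ(μ) = min over nonempty S of (2·e^σ_min(S) + |E(S, S̄)|) / vol_μ(S).
--
-- A switching τ : V → {+,-} splits a vertex set S into its sides
-- V₊ = {u ∈ S | τ u = +} and V₋ = {u ∈ S | τ u = -}.  Call an edge of Γ_S frustrated
-- by τ when σ(uv) ≠ τ(u)τ(v), and let cost S τ be the weight of these edges.  The
-- frustrated edges are exactly the positive edges between V₊ and V₋ and the negative
-- edges inside V₊ or V₋, hence
--     numerator of β^σ(V₊, V₋)  =  2·cost S τ + |E(S, S̄)|,
-- and every disjoint pair (V₁, V₂) is the pair of sides of a switching of V₁ ∪ V₂.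
-- On the other hand e^σ_min(S) is the least cost over all switchings: deleting the
-- frustrated edges of τ leaves a graph on which τ makes every edge positive, which is
-- balanced; conversely (Harary) a balanced graph has a switching making all its edges
-- positive, so every balancing deletion contains the frustrated edges of some switching.
-- Hence both minimisation problems range over the same numerators and volumes.

open import Defs
open import Data.Nat using (ℕ)
open import Data.Fin using (Fin)
open import Function.Bundles using (_⇔_; mk⇔)

import Data.Nat as ℕ
import Data.Nat.Properties as ℕₚ
open import Algebra.Bundles using (CommutativeMonoid)
open import Data.Bool using (Bool; true; false; _∧_; _∨_; not; if_then_else_)
open import Data.Bool.Properties
  using (∧-comm; ∨-comm; ∧-zeroʳ; ∧-identityʳ; ∨-zeroʳ; ¬-not; T-≡; ∧-commutativeMonoid)
  renaming (_≟_ to _≟ᵇ_)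
open import Algebra.Properties.CommutativeSemigroup
  (CommutativeMonoid.commutativeSemigroup ∧-commutativeMonoid) using (x∙yz≈y∙xz)
open import Data.Fin using (zero; suc; toℕ; _≟_)
open import Data.Fin.Properties using (injective⇒≤; toℕ-injective; any?)
open import Data.Fin.Subset using (Subset; _∪_; ∁)
open import Data.Vec using (lookup; tabulate)
open import Data.Vec.Properties using (lookup∘tabulate; lookup-zipWith; tabulate∘lookup; tabulate-cong)
import Data.Vec.Functional as Vector
open import Data.List as List using (List; []; _∷_; _++_; [_]; length; allFin; cartesianProduct)
open import Data.List.Relation.Unary.All as All using (All; []; _∷_)
open import Data.List.Relation.Unary.All.Properties using (++⁺; ¬Any⇒All¬)
open import Data.List.Relation.Unary.Any using (here; there)
open import Data.List.Relation.Unary.AllPairs using ([]; _∷_)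
open import Data.List.Relation.Unary.Unique.Propositional using (Unique)
open import Data.List.Membership.Propositional using (_∈_)
open import Data.List.Membership.Propositional.Properties using (∈-allFin; ∈-cartesianProduct⁺; ∈-lookup)
open import Data.Product using (Σ; ∃; _×_; _,_; proj₁; proj₂)
open import Data.Sum using (_⊎_; inj₁; inj₂) renaming ([_,_]′ to either)
open import Data.Empty using (⊥-elim)
open import Data.Sign as Sign using (Sign; opposite) renaming (_*_ to _·_)
open import Data.Sign.Properties
  using (*-assoc; *-comm; *-identityʳ; *-cancelˡ-≡; s*s≡+; opposite-involutive)
  renaming (_≟_ to _≟ˢ_)
open import Relation.Nullary using (¬_; Dec; yes; no; does)
open import Relation.Nullary.Decidable using (dec-true)
open import Relation.Binary.PropositionalEquality
  using (_≡_; _≢_; refl; sym; trans; cong; cong₂; subst; subst₂; module ≡-Reasoning)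
open import Relation.Binary.Structures using (IsTotalOrder)
open import Relation.Binary.Definitions using (tri<; tri≈; tri>)
import Relation.Binary.Reasoning.Setoid as SetoidReasoning
open import Function.Base using (_∘_; id)
open import Function.Bundles using (Equivalence)

-- Conjunctions and disjunctions known to be true.
∧-true : ∀ x {y} → x ∧ y ≡ true → x ≡ true × y ≡ true
∧-true true e = refl , e

-- The four conjuncts of an edge predicate of the form adj ∧ S∋u ∧ S∋v ∧ condition.
∧₄-true : ∀ x y z {w} → x ∧ y ∧ z ∧ w ≡ true → x ≡ true × y ≡ true × z ≡ true × w ≡ true
∧₄-true true true true e = refl , refl , refl , e

∨-true : ∀ x {y} → x ∨ y ≡ true → x ≡ true ⊎ y ≡ true
∨-true true  _ = inj₁ refl
∨-true false e = inj₂ e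

-- Exchanging the first two conjuncts (symmetry of the edge predicates below).
∧-exchange : ∀ x y z → x ∧ (y ∧ z) ≡ y ∧ (x ∧ z)
∧-exchange = x∙yz≈y∙xz

-- Two Booleans that imply each other are equal.
⇔⇒≡ : ∀ {b c} → (b ≡ true → c ≡ true) → (c ≡ true → b ≡ true) → b ≡ c
⇔⇒≡ {true}          b⇒c _   = sym (b⇒c refl)
⇔⇒≡ {false} {true}  _   c⇒b = c⇒b refl
⇔⇒≡ {false} {false} _   _   = refl

-- An edge kept after deleting the frustrated ones (see `frustrated`) is not frustrated.
survivor : ∀ x y z w → x ∧ y ∧ z ∧ not (x ∧ y ∧ z ∧ not w) ≡ true → w ≡ true
survivor true  true  true  true  _ = refl
survivor true  true  true  false ()
survivor true  true  false w     ()
survivor true  false z     w     ()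
survivor false y     z     w     ()

-- A decision whose Boolean is true yields a witness.
does⇒witness : ∀ {P : Set} (d : Dec P) → does d ≡ true → P
does⇒witness (yes p) _ = p
does⇒witness (no _)  ()

-- Boolean equality of vertices.
_==_ : ∀ {n} → Fin n → Fin n → Bool
u == v = does (u ≟ v)

-- Every vertex equals itself.
==-refl : ∀ {n} (u : Fin n) → (u == u) ≡ true
==-refl u = dec-true (u ≟ u) refl

-- Does some vertex satisfy the Boolean predicate p?
someVertex : ∀ {n} → (Fin n → Bool) → Bool
someVertex p = does (any? (λ y → p y ≟ᵇ true))

-- A witness makes `someVertex` true.
someVertex-intro : ∀ {n} (p : Fin n → Bool) y → p y ≡ true → someVertex p ≡ true
someVertex-intro p y e = dec-true (any? (λ y → p y ≟ᵇ true)) (y , e)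

-- Products of sign ratios telescope.
·-telescope : ∀ a b c → (a · b) · (b · c) ≡ a · c
·-telescope a b c = begin
  (a · b) · (b · c)   ≡⟨ *-assoc a b (b · c) ⟩
  a · (b · (b · c))   ≡⟨ cong (a ·_) (sym (*-assoc b b c)) ⟩
  a · ((b · b) · c)   ≡⟨ cong (λ x → a · (x · c)) (s*s≡+ b) ⟩
  a · c               ∎
  where open ≡-Reasoning

-- In the sign group x·s = + forces s = x.
·≡+⇒≡ : ∀ x s → x · s ≡ Sign.+ → s ≡ x
·≡+⇒≡ x s e = *-cancelˡ-≡ x s x (trans e (sym (s*s≡+ x)))

-- A sign different from t is the opposite of t.
≢⇒opposite : ∀ {s t} → s ≢ t → s ≡ opposite t
≢⇒opposite {Sign.+} {Sign.+} ne = ⊥-elim (ne refl)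
≢⇒opposite {Sign.+} {Sign.-} _  = refl
≢⇒opposite {Sign.-} {Sign.+} _  = refl
≢⇒opposite {Sign.-} {Sign.-} ne = ⊥-elim (ne refl)

-- Flipping one factor flips the product; flipping both leaves it unchanged.
opposite-·ˡ : ∀ x y → opposite x · y ≡ opposite (x · y)
opposite-·ˡ Sign.+ y = refl
opposite-·ˡ Sign.- y = sym (opposite-involutive y)

opposite-·-opposite : ∀ x y → opposite x · opposite y ≡ x · y
opposite-·-opposite Sign.+ Sign.+ = refl
opposite-·-opposite Sign.+ Sign.- = refl
opposite-·-opposite Sign.- Sign.+ = refl
opposite-·-opposite Sign.- Sign.- = refl

-- A repetition-free list of vertices has at most n entries, since its lookup is injective.
unique-length≤ : ∀ {n} {xs : List (Fin n)} → Unique xs → length xs ℕ.≤ n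
unique-length≤ uniq = injective⇒≤ (λ {i} {j} → lookup-injective uniq i j)
  where
  lookup-injective : ∀ {A : Set} {xs : List A} → Unique xs →
                     ∀ i j → List.lookup xs i ≡ List.lookup xs j → i ≡ j
  lookup-injective (_  ∷ _) zero    zero    _ = refl
  lookup-injective (x∉ ∷ _) zero    (suc j) e = ⊥-elim (All.lookup x∉ (∈-lookup j) e)
  lookup-injective (x∉ ∷ _) (suc i) zero    e = ⊥-elim (All.lookup x∉ (∈-lookup i) (sym e))
  lookup-injective (_  ∷ u) (suc i) (suc j) e = cong suc (lookup-injective u i j e)

module _ (F : OrderedField) where
  open OrderedField F
    using (Carrier; _≈_; _≤_; _+_; 0#; setoid; isTotalOrder; +-commutativeMonoid;
           +-cong; +-comm; +-identityˡ; +-identityʳ; +-mono-≤)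
    renaming (refl to ≈-refl; sym to ≈-sym; trans to ≈-trans; reflexive to ≈-reflexive)
  open IsTotalOrder isTotalOrder
    using (total)
    renaming (refl to ≤-refl; reflexive to ≤-reflexive; trans to ≤-trans; antisym to ≤-antisym;
              ≲-respˡ-≈ to ≤-respˡ-≈; ≲-respʳ-≈ to ≤-respʳ-≈)
  open import Algebra.Properties.CommutativeMonoid.Sum +-commutativeMonoid
    using (sum; ∑-distrib-+; ∑-comm; sum-cong-≋; sum-cong-≗)

  -- Addition is monotone in each argument.
  +-monoʳ-≤ : ∀ c {a b} → a ≤ b → (c + a) ≤ (c + b)
  +-monoʳ-≤ c {a} {b} a≤b = ≤-respʳ-≈ (+-comm b c) (≤-respˡ-≈ (+-comm a c) (+-mono-≤ c a≤b))

  +-mono₂-≤ : ∀ {a b c d} → a ≤ b → c ≤ d → (a + c) ≤ (b + d)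
  +-mono₂-≤ {b = b} {c} a≤b c≤d = ≤-trans (+-mono-≤ c a≤b) (+-monoʳ-≤ b c≤d)

  -- The numerators (e + e) + c of both quotients are monotone in e.
  double-mono : ∀ c {a b} → a ≤ b → ((a + a) + c) ≤ ((b + b) + c)
  double-mono c a≤b = +-mono-≤ c (+-mono₂-≤ a≤b a≤b)

  -- Sums of four terms of which at most one is nonzero.
  zero-of-four : 0# ≈ ((0# + 0#) + 0#) + 0#
  zero-of-four = ≈-sym (≈-trans (+-identityʳ _) (≈-trans (+-identityʳ _) (+-identityʳ 0#)))

  first-of-four : ∀ x → x ≈ ((x + 0#) + 0#) + 0#
  first-of-four x = ≈-sym (≈-trans (+-identityʳ _) (≈-trans (+-identityʳ _) (+-identityʳ x)))

  second-of-four : ∀ x → x ≈ ((0# + x) + 0#) + 0#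
  second-of-four x = ≈-sym (≈-trans (+-identityʳ _) (≈-trans (+-identityʳ _) (+-identityˡ x)))

  third-of-four : ∀ x → x ≈ ((0# + 0#) + x) + 0#
  third-of-four x = ≈-sym (≈-trans (+-identityʳ _) (≈-trans (+-cong (+-identityʳ 0#) ≈-refl) (+-identityˡ x)))

  fourth-of-four : ∀ x → x ≈ ((0# + 0#) + 0#) + x
  fourth-of-four x = ≈-sym (≈-trans (+-cong (≈-trans (+-identityʳ _) (+-identityʳ 0#)) ≈-refl) (+-identityˡ x))

  -- The finite sums and indicator summands of Defs, with the field fixed.
  ∑ : ∀ {m} → (Fin m → Carrier) → Carrier
  ∑ = ΣF F

  infix 30 ⟦_⟧·_
  ⟦_⟧·_ : Bool → Carrier → Carrier
  ⟦ b ⟧· x = [_]· F b x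

  -- Double sum over ordered pairs.
  ∑∑ : ∀ {m} → (Fin m → Fin m → Carrier) → Carrier
  ∑∑ h = ∑ λ u → ∑ λ v → h u v

  -- ∑ is the library's monoid sum, so its congruence, additivity and exchange laws
  -- transfer from Algebra.Properties.CommutativeMonoid.Sum.
  ∑≡sum : ∀ {m} (f : Fin m → Carrier) → ∑ f ≡ sum f
  ∑≡sum {ℕ.zero}  f = refl
  ∑≡sum {ℕ.suc m} f = cong (f zero +_) (∑≡sum (f ∘ suc))

  ∑∑≡sum : ∀ {m} (h : Fin m → Fin m → Carrier) → ∑∑ h ≡ sum (λ u → sum (h u))
  ∑∑≡sum h = trans (∑≡sum (λ u → ∑ (h u))) (sum-cong-≗ (λ u → ∑≡sum (h u)))

  ∑-cong : ∀ {m} {f g : Fin m → Carrier} → (∀ i → f i ≈ g i) → ∑ f ≈ ∑ g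
  ∑-cong {f = f} {g} f≈g = subst₂ _≈_ (sym (∑≡sum f)) (sym (∑≡sum g)) (sum-cong-≋ f≈g)

  ∑-+ : ∀ {m} (f g : Fin m → Carrier) → ∑ (λ i → f i + g i) ≈ ∑ f + ∑ g
  ∑-+ f g = subst₂ _≈_ (sym (∑≡sum (λ i → f i + g i))) (sym (cong₂ _+_ (∑≡sum f) (∑≡sum g))) (∑-distrib-+ f g)

  ∑-mono : ∀ {m} {f g : Fin m → Carrier} → (∀ i → f i ≤ g i) → ∑ f ≤ ∑ g
  ∑-mono {ℕ.zero}  _   = ≤-refl
  ∑-mono {ℕ.suc m} f≤g = +-mono₂-≤ (f≤g zero) (∑-mono (f≤g ∘ suc))

  ∑∑-cong : ∀ {m} {h k : Fin m → Fin m → Carrier} → (∀ u v → h u v ≈ k u v) → ∑∑ h ≈ ∑∑ k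
  ∑∑-cong h≈k = ∑-cong (λ u → ∑-cong (h≈k u))

  ∑∑-+ : ∀ {m} (h k : Fin m → Fin m → Carrier) → ∑∑ (λ u v → h u v + k u v) ≈ ∑∑ h + ∑∑ k
  ∑∑-+ h k = ≈-trans (∑-cong (λ u → ∑-+ (h u) (k u))) (∑-+ (λ u → ∑ (h u)) (λ u → ∑ (k u)))

  -- Exchanging the roles of the two summation variables.
  ∑∑-transpose : ∀ {m} (h : Fin m → Fin m → Carrier) → ∑∑ (λ u v → h v u) ≈ ∑∑ h
  ∑∑-transpose h = subst₂ _≈_ (sym (∑∑≡sum (λ u v → h v u))) (sym (∑∑≡sum h)) (∑-comm (λ u v → h v u))

  -- The summand ⟦ b ⟧· x respects ≈ and vanishes with x.
  ⟦⟧-cong : ∀ b {x y} → x ≈ y → ⟦ b ⟧· x ≈ ⟦ b ⟧· y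
  ⟦⟧-cong true  x≈y = x≈y
  ⟦⟧-cong false _   = ≈-refl

  ⟦⟧-zero : ∀ b {x} → x ≈ 0# → ⟦ b ⟧· x ≈ 0#
  ⟦⟧-zero true  x≈0 = x≈0
  ⟦⟧-zero false _   = ≈-refl

  -- For x ≥ 0 the summand ⟦ b ⟧· x is monotone in the condition b.
  ⟦⟧-mono : ∀ b c {x} → (b ≡ true → c ≡ true) → 0# ≤ x → ⟦ b ⟧· x ≤ ⟦ c ⟧· x
  ⟦⟧-mono true  c     b⇒c _   rewrite b⇒c refl = ≤-refl
  ⟦⟧-mono false true  _   0≤x = 0≤x
  ⟦⟧-mono false false _   _   = ≤-refl

  -- A function of a switching of m vertices attains its minimum (there are 2^m switchings).
  argmin-switching : ∀ m (g : (Fin m → Sign) → Carrier) →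
                     (∀ {τ τ'} → (∀ u → τ u ≡ τ' u) → g τ ≈ g τ') →
                     ∃ λ τ₀ → ∀ τ → g τ₀ ≤ g τ
  argmin-switching ℕ.zero    g g-ext = (λ ()) , λ τ → ≤-reflexive (g-ext (λ ()))
  argmin-switching (ℕ.suc m) g g-ext = pick (total (g τ₊) (g τ₋))
    where
    -- g on the switchings with a prescribed sign s at the first vertex
    g-from : Sign → (Fin m → Sign) → Carrier
    g-from s τ = g (s Vector.∷ τ)

    cons-cong : ∀ s {τ τ' : Fin m → Sign} → (∀ u → τ u ≡ τ' u) → ∀ u → (s Vector.∷ τ) u ≡ (s Vector.∷ τ') u
    cons-cong s _     zero    = refl
    cons-cong s τ≗τ' (suc u) = τ≗τ' u

    -- by induction, a best switching with each prescribed first sign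
    best-from : ∀ s → ∃ λ τ → ∀ τ' → g-from s τ ≤ g-from s τ'
    best-from s = argmin-switching m (g-from s) (g-ext ∘ cons-cong s)

    τ₊ τ₋ : Fin (ℕ.suc m) → Sign
    τ₊ = Sign.+ Vector.∷ proj₁ (best-from Sign.+)
    τ₋ = Sign.- Vector.∷ proj₁ (best-from Sign.-)

    restore : ∀ τ {s} → τ zero ≡ s → ∀ u → (s Vector.∷ Vector.tail τ) u ≡ τ u
    restore τ e zero    = sym e
    restore τ e (suc u) = refl

    -- every switching costs at least one of the two candidates
    below : ∀ τ → g τ₊ ≤ g τ ⊎ g τ₋ ≤ g τ
    below τ with τ zero in e
    ... | Sign.+ = inj₁ (≤-respʳ-≈ (g-ext (restore τ e)) (proj₂ (best-from Sign.+) (Vector.tail τ)))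
    ... | Sign.- = inj₂ (≤-respʳ-≈ (g-ext (restore τ e)) (proj₂ (best-from Sign.-) (Vector.tail τ)))

    pick : g τ₊ ≤ g τ₋ ⊎ g τ₋ ≤ g τ₊ → ∃ λ τ₀ → ∀ τ → g τ₀ ≤ g τ
    pick (inj₁ ₊≤₋) = τ₊ , λ τ → either id (≤-trans ₊≤₋) (below τ)
    pick (inj₂ ₋≤₊) = τ₋ , λ τ → either (≤-trans ₋≤₊) id (below τ)

  -- Last vertex of the walk x ∷ ps.
  endpoint : ∀ {A : Set} → A → List A → A
  endpoint x []       = x
  endpoint x (y ∷ ys) = endpoint y ys

  endpoint-snoc : ∀ {A : Set} (x : A) xs z → endpoint x (xs ++ [ z ]) ≡ z
  endpoint-snoc x []       z = refl
  endpoint-snoc x (y ∷ ys) z = endpoint-snoc y ys z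

  -- Appending z to a walk adds one step, from its endpoint to z.
  consec-snoc : ∀ {A : Set} (x : A) xs z →
                consec F (x ∷ xs ++ [ z ]) ≡ consec F (x ∷ xs) ++ [ (endpoint x xs , z) ]
  consec-snoc x []       z = refl
  consec-snoc x (y ∷ ys) z = cong ((x , y) ∷_) (consec-snoc y ys z)

  module _ {n : ℕ} (Γ : SignedGraph F n) where
    open SignedGraph Γ
    open import Data.List.Membership.DecPropositional (_≟_ {n = n}) using (_∈?_)

    -- Product of the signs along a list of directed edges.
    signOf : List (Fin n × Fin n) → Sign
    signOf []             = Sign.+
    signOf ((u , v) ∷ es) = σ u v · signOf es

    -- The cycle sign of Defs is signOf of the closed walk.
    cycleSign≡signOf : ∀ vs → cycleSign F Γ vs ≡ signOf (cycEdges F vs)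
    cycleSign≡signOf vs = foldr≡signOf _ (λ _ _ _ → refl) (cycEdges F vs)
      where
      foldr≡signOf : (f : Fin n × Fin n → Sign → Sign) → (∀ u v s → f (u , v) s ≡ σ u v · s) →
                     ∀ es → List.foldr f Sign.+ es ≡ signOf es
      foldr≡signOf f f≡ []             = refl
      foldr≡signOf f f≡ ((u , v) ∷ es) = trans (f≡ u v _) (cong (σ u v ·_) (foldr≡signOf f f≡ es))

    -- signOf is multiplicative over concatenation.
    signOf-++ : ∀ es fs → signOf (es ++ fs) ≡ signOf es · signOf fs
    signOf-++ []             fs = refl
    signOf-++ ((u , v) ∷ es) fs =
      trans (cong (σ u v ·_) (signOf-++ es fs)) (sym (*-assoc (σ u v) (signOf es) (signOf fs)))

    -- The sign of the closed walk through x ∷ ps: the open walk times the closing edge.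
    cycle-split : ∀ x ps → signOf (cycEdges F (x ∷ ps)) ≡ signOf (consec F (x ∷ ps)) · σ (endpoint x ps) x
    cycle-split x ps = begin
      signOf (consec F (x ∷ ps ++ [ x ]))                        ≡⟨ cong signOf (consec-snoc x ps x) ⟩
      signOf (consec F (x ∷ ps) ++ [ (endpoint x ps , x) ])      ≡⟨ signOf-++ (consec F (x ∷ ps)) _ ⟩
      signOf (consec F (x ∷ ps)) · (σ (endpoint x ps) x · Sign.+) ≡⟨ cong (signOf (consec F (x ∷ ps)) ·_) (*-identityʳ _) ⟩
      signOf (consec F (x ∷ ps)) · σ (endpoint x ps) x            ∎
      where open ≡-Reasoning

    -- All the listed directed edges belong to the graph H.
    Along : (Fin n → Fin n → Bool) → List (Fin n × Fin n) → Set
    Along H = All (λ e → H (proj₁ e) (proj₂ e) ≡ true)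

    -- τ is consistent with H when the switching τ makes every edge of H positive.
    Consistent : (Fin n → Sign) → (Fin n → Fin n → Bool) → Set
    Consistent τ H = ∀ u v → H u v ≡ true → σ u v ≡ τ u · τ v

    -- Along a walk in H with τ consistent, the signs telescope to τ(start)·τ(end).
    telescope : ∀ {τ H} → Consistent τ H → ∀ x ps → Along H (consec F (x ∷ ps)) →
                signOf (consec F (x ∷ ps)) ≡ τ x · τ (endpoint x ps)
    telescope {τ} cons x []       []          = sym (s*s≡+ (τ x))
    telescope {τ} cons x (y ∷ ys) (xy ∷ walk) =
      trans (cong₂ _·_ (cons x y xy) (telescope {τ} cons y ys walk)) (·-telescope (τ x) (τ y) (τ (endpoint y ys)))

    -- A graph admitting a consistent switching is balanced (the easy half of Harary's theorem).
    consistent⇒balanced : ∀ {τ A} → Consistent τ A → Balanced F Γ A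
    consistent⇒balanced     cons []       (() , _)
    consistent⇒balanced {τ} cons (x ∷ xs) (_ , _ , closed) = begin
      cycleSign F Γ (x ∷ xs)               ≡⟨ cycleSign≡signOf (x ∷ xs) ⟩
      signOf (consec F (x ∷ xs ++ [ x ]))  ≡⟨ telescope {τ} cons x (xs ++ [ x ]) closed ⟩
      τ x · τ (endpoint x (xs ++ [ x ]))   ≡⟨ cong (λ y → τ x · τ y) (endpoint-snoc x xs x) ⟩
      τ x · τ x                            ≡⟨ s*s≡+ (τ x) ⟩
      Sign.+                               ∎
      where open ≡-Reasoning

    -- Simple walks in a graph H on the vertices of Γ.
    module Paths (H : Fin n → Fin n → Bool) where

      -- A repetition-free walk x ∷ ps in H ending at t.
      SimpleWalk : Fin n → Fin n → Set
      SimpleWalk x t = Σ (List (Fin n)) λ ps →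
        Unique (x ∷ ps) × Along H (consec F (x ∷ ps)) × endpoint x ps ≡ t

      -- The part of a simple walk from any of its vertices on is again a simple walk.
      suffix : ∀ {x z t} (w : SimpleWalk z t) → x ∈ (z ∷ proj₁ w) → SimpleWalk x t
      suffix w (here refl) = w
      suffix ([]     , _) (there ())
      suffix (z' ∷ zs , _ ∷ uniq , _ ∷ walk , end) (there x∈) = suffix (zs , uniq , walk , end) x∈

      -- Prepending an edge to a simple walk, shortcutting if the new vertex already occurs.
      extend : ∀ {x y t} → H x y ≡ true → SimpleWalk y t → SimpleWalk x t
      extend {x} {y} xy w@(ps , uniq , walk , end) with x ∈? (y ∷ ps)
      ... | yes x∈ = suffix w x∈
      ... | no  x∉ = y ∷ ps , ¬Any⇒All¬ (y ∷ ps) x∉ ∷ uniq , xy ∷ walk , end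

      -- The connected component of a in the symmetric graph H.
      module Component (H-sym : ∀ {u v} → H u v ≡ true → H v u ≡ true) (a : Fin n) where

        -- reach k x: x is joined to a by a walk of at most k steps.
        reach : ℕ → Fin n → Bool
        reach ℕ.zero    x = x == a
        reach (ℕ.suc k) x = reach k x ∨ someVertex (λ y → H x y ∧ reach k y)

        -- Reachability is witnessed by a simple walk, and every walk gives reachability.
        reach⇒walk : ∀ k x → reach k x ≡ true → SimpleWalk x a
        reach⇒walk ℕ.zero x e with does⇒witness (x ≟ a) e
        ... | refl = [] , [] ∷ [] , [] , refl
        reach⇒walk (ℕ.suc k) x e with ∨-true (reach k x) e
        ... | inj₁ r = reach⇒walk k x r
        ... | inj₂ s with does⇒witness (any? (λ y → (H x y ∧ reach k y) ≟ᵇ true)) s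
        ... | y , xy∧r = extend (proj₁ (∧-true (H x y) xy∧r)) (reach⇒walk k y (proj₂ (∧-true (H x y) xy∧r)))

        walk⇒reach : ∀ x ps → Along H (consec F (x ∷ ps)) → endpoint x ps ≡ a → reach (length ps) x ≡ true
        walk⇒reach x []       []          refl = ==-refl x
        walk⇒reach x (y ∷ ps) (xy ∷ walk) end =
          trans (cong (reach (length ps) x ∨_) (someVertex-intro _ y step)) (∨-zeroʳ _)
          where step : (H x y ∧ reach (length ps) y) ≡ true
                step = cong₂ _∧_ xy (walk⇒reach y ps walk end)

        -- More steps reach at least as much.
        reach-mono : ∀ j k x → reach k x ≡ true → reach (j ℕ.+ k) x ≡ true
        reach-mono ℕ.zero    k x e = e
        reach-mono (ℕ.suc j) k x e rewrite reach-mono j k x e = refl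

        -- Membership in the component: reachability within n steps, which suffices for simple walks.
        inComponent : Fin n → Bool
        inComponent = reach n

        walk⇒inComponent : ∀ {x} → SimpleWalk x a → inComponent x ≡ true
        walk⇒inComponent {x} (ps , uniq , walk , end) =
          subst (λ k → reach k x ≡ true) (ℕₚ.m∸n+n≡m ps≤n)
                (reach-mono (n ℕ.∸ length ps) (length ps) x (walk⇒reach x ps walk end))
          where ps≤n : length ps ℕ.≤ n
                ps≤n = ℕₚ.≤-trans (ℕₚ.n≤1+n _) (unique-length≤ uniq)

        -- a lies in its component, and the component is closed under edges of H.
        inComponent-a : inComponent a ≡ true
        inComponent-a = walk⇒inComponent ([] , [] ∷ [] , [] , refl)

        inComponent-closed : ∀ {x y} → H x y ≡ true → inComponent y ≡ true → inComponent x ≡ true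
        inComponent-closed xy y∈ = walk⇒inComponent (extend xy (reach⇒walk n _ y∈))

        -- No edge of H leaves the component.
        inComponent-edge : ∀ {u v} → H u v ≡ true → inComponent u ≡ inComponent v
        inComponent-edge uv = ⇔⇒≡ (inComponent-closed (H-sym uv)) (inComponent-closed uv)

    -- Switching τ on the vertices where C holds.
    flipOn : (Fin n → Bool) → (Fin n → Sign) → Fin n → Sign
    flipOn C τ x = if C x then opposite (τ x) else τ x

    -- Flipping a set of vertices that no edge of H leaves keeps τ consistent with H.
    flip-consistent : ∀ {τ H} (C : Fin n → Bool) → (∀ {u v} → H u v ≡ true → C u ≡ C v) →
                      Consistent τ H → Consistent (flipOn C τ) H
    flip-consistent {τ} C C-edge cons u v uv with C u | C v | C-edge uv
    ... | true  | true  | _ = trans (cons u v uv) (sym (opposite-·-opposite (τ u) (τ v)))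
    ... | false | false | _ = cons u v uv

    -- Harary's theorem (the direction needed here): a balanced symmetric loopless
    -- graph A on the vertices of Γ admits a switching consistent with all its edges.
    -- The switching is built by adding the edges of A one at a time.
    module Harary (A : Fin n → Fin n → Bool) (A-sym : ∀ u v → A u v ≡ A v u)
                  (A-irr : ∀ u → A u u ≡ false) (balanced : Balanced F Γ A) where

      -- Some switching is consistent with H.
      ConsistentSwitching : (Fin n → Fin n → Bool) → Set
      ConsistentSwitching H = ∃ λ τ → Consistent τ H

      -- The subgraph of A formed by the listed edges, taken in either orientation.
      spanned : List (Fin n × Fin n) → Fin n → Fin n → Bool
      spanned []            u v = false
      spanned ((a , b) ∷ L) u v = (A a b ∧ ((u == a ∧ v == b) ∨ (u == b ∧ v == a))) ∨ spanned L u v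

      -- The spanned graph is symmetric, contained in A, and contains every listed edge of A.
      spanned-swap : ∀ L u v → spanned L u v ≡ spanned L v u
      spanned-swap []            u v = refl
      spanned-swap ((a , b) ∷ L) u v = cong₂ _∨_ (cong (A a b ∧_) orientations) (spanned-swap L u v)
        where
        open ≡-Reasoning
        orientations : ((u == a ∧ v == b) ∨ (u == b ∧ v == a)) ≡ ((v == a ∧ u == b) ∨ (v == b ∧ u == a))
        orientations = begin
          (u == a ∧ v == b) ∨ (u == b ∧ v == a) ≡⟨ ∨-comm (u == a ∧ v == b) _ ⟩
          (u == b ∧ v == a) ∨ (u == a ∧ v == b) ≡⟨ cong₂ _∨_ (∧-comm (u == b) _) (∧-comm (u == a) _) ⟩
          (v == a ∧ u == b) ∨ (v == b ∧ u == a) ∎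

      spanned-sym : ∀ L {u v} → spanned L u v ≡ true → spanned L v u ≡ true
      spanned-sym L {u} {v} e = trans (spanned-swap L v u) e

      -- An edge of the spanned graph is the first listed edge or an edge spanned by the rest.
      spanned-cases : ∀ a b L {u v} → spanned ((a , b) ∷ L) u v ≡ true →
                      (A a b ≡ true × ((u ≡ a × v ≡ b) ⊎ (u ≡ b × v ≡ a))) ⊎ spanned L u v ≡ true
      spanned-cases a b L {u} {v} e with ∨-true _ e
      ... | inj₂ old = inj₂ old
      ... | inj₁ new with ∧-true (A a b) new
      ... | ab , orientation with ∨-true (u == a ∧ v == b) orientation
      ... | inj₁ same = let (ua , vb) = ∧-true (u == a) same in
                        inj₁ (ab , inj₁ (does⇒witness (u ≟ a) ua , does⇒witness (v ≟ b) vb))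
      ... | inj₂ flip = let (ub , va) = ∧-true (u == b) flip in
                        inj₁ (ab , inj₂ (does⇒witness (u ≟ b) ub , does⇒witness (v ≟ a) va))

      spanned⊆A : ∀ L {u v} → spanned L u v ≡ true → A u v ≡ true
      spanned⊆A ((a , b) ∷ L) e with spanned-cases a b L e
      ... | inj₁ (ab , inj₁ (refl , refl)) = ab
      ... | inj₁ (ab , inj₂ (refl , refl)) = trans (A-sym b a) ab
      ... | inj₂ old                       = spanned⊆A L old

      spanned-complete : ∀ L {u v} → (u , v) ∈ L → A u v ≡ true → spanned L u v ≡ true
      spanned-complete ((u , v) ∷ L) (here refl) uv rewrite uv | ==-refl u | ==-refl v = refl
      spanned-complete (_ ∷ L)       (there p)   uv rewrite spanned-complete L p uv = ∨-zeroʳ _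

      -- A switching consistent with the old edges and with ab is consistent with all of them.
      consistent-∷ : ∀ {τ a b L} → Consistent τ (spanned L) → (A a b ≡ true → σ a b ≡ τ a · τ b) →
                     Consistent τ (spanned ((a , b) ∷ L))
      consistent-∷ {τ} {a} {b} {L} cons new u v e with spanned-cases a b L e
      ... | inj₁ (ab , inj₁ (refl , refl)) = new ab
      ... | inj₁ (ab , inj₂ (refl , refl)) = trans (σ-sym b a) (trans (new ab) (*-comm (τ a) (τ b)))
      ... | inj₂ old                       = cons u v old

      -- If τ is consistent with H ⊆ A but not with the edge ab of A, then no simple walk
      -- in H joins b to a: closed up by ab it would be a cycle of A of negative sign.
      inconsistent-edge-separates : ∀ {τ H} → (∀ {u v} → H u v ≡ true → A u v ≡ true) → Consistent τ H →
                                    ∀ {a b} → A a b ≡ true → σ a b ≢ τ a · τ b → ¬ Paths.SimpleWalk H b a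
      inconsistent-edge-separates H⊆A cons ab bad ([] , _ , _ , refl) with trans (sym ab) (A-irr _)
      ... | ()
      inconsistent-edge-separates {τ} H⊆A cons {a} {b} ab bad (_ ∷ [] , _ , ba ∷ [] , refl) =
        bad (trans (σ-sym a b) (trans (cons b a ba) (*-comm (τ b) (τ a))))
      inconsistent-edge-separates {τ} {H} H⊆A cons {a} {b} ab bad (ps@(_ ∷ _ ∷ _) , uniq , walk , refl) =
        bad (trans (·≡+⇒≡ (τ b · τ a) (σ a b) positive) (*-comm (τ b) (τ a)))
        where
        cycle : IsCycle F Γ A (b ∷ ps)
        cycle = ℕ.s≤s (ℕ.s≤s (ℕ.s≤s ℕ.z≤n)) , uniq ,
                subst (Along A) (sym (consec-snoc b ps b)) (++⁺ (All.map H⊆A walk) (ab ∷ []))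
        positive : (τ b · τ a) · σ a b ≡ Sign.+
        positive = begin
          (τ b · τ a) · σ a b                  ≡⟨ cong (_· σ a b) (sym (telescope {τ} cons b ps walk)) ⟩
          signOf (consec F (b ∷ ps)) · σ a b   ≡⟨ sym (cycle-split b ps) ⟩
          signOf (cycEdges F (b ∷ ps))         ≡⟨ sym (cycleSign≡signOf (b ∷ ps)) ⟩
          cycleSign F Γ (b ∷ ps)               ≡⟨ balanced (b ∷ ps) cycle ⟩
          Sign.+                               ∎
          where open ≡-Reasoning

      -- Adding an edge ab: keep τ if ab is consistent, otherwise flip the component of a,
      -- which by the previous lemma does not contain b.
      add-edge : ∀ a b L → ConsistentSwitching (spanned L) → ConsistentSwitching (spanned ((a , b) ∷ L))
      add-edge a b L (τ , cons) with A a b ≟ᵇ true | σ a b ≟ˢ τ a · τ b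
      ... | no ¬ab | _       = τ , consistent-∷ {τ} {L = L} cons (⊥-elim ∘ ¬ab)
      ... | yes _  | yes ok  = τ , consistent-∷ {τ} {L = L} cons (λ _ → ok)
      ... | yes ab | no  bad = τ′ , consistent-∷ {τ′} {L = L} (flip-consistent {τ} inComponent inComponent-edge cons)
                                                          (λ _ → flipped)
        where
        open Paths.Component (spanned L) (spanned-sym L) a
        τ′ : Fin n → Sign
        τ′ = flipOn inComponent τ
        b-outside : inComponent b ≡ false
        b-outside = ¬-not (λ b∈ → inconsistent-edge-separates {τ} (spanned⊆A L) cons ab bad (reach⇒walk n b b∈))
        flipped : σ a b ≡ τ′ a · τ′ b
        flipped rewrite inComponent-a | b-outside = trans (≢⇒opposite bad) (sym (opposite-·ˡ (τ a) (τ b)))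

      -- Induction on the list of edges; listing all pairs spans the whole of A.
      consistent-on : ∀ L → ConsistentSwitching (spanned L)
      consistent-on []            = (λ _ → Sign.+) , λ _ _ ()
      consistent-on ((a , b) ∷ L) = add-edge a b L (consistent-on L)

      harary : ConsistentSwitching A
      harary with consistent-on (cartesianProduct (allFin n) (allFin n))
      ... | τ , cons = τ , λ u v uv →
            cons u v (spanned-complete _ (∈-cartesianProduct⁺ (∈-allFin u) (∈-allFin v)) uv)

    -- Edges of Γ_S made negative by the switching τ: the frustrated edges of τ.
    frustrated : Subset n → (Fin n → Sign) → Fin n → Fin n → Bool
    frustrated S τ u v = adj u v ∧ lookup S u ∧ lookup S v ∧ not (isSign F Γ (σ u v) (τ u · τ v))

    -- The weight of the frustrated edges: the cost of the switching τ on S.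
    cost : Subset n → (Fin n → Sign) → Carrier
    cost S τ = edgeWeight F Γ (frustrated S τ)

    -- isSign is the Boolean equality test on signs.
    isSign-≡ : ∀ {s t} → isSign F Γ s t ≡ true → s ≡ t
    isSign-≡ {Sign.+} {Sign.+} _ = refl
    isSign-≡ {Sign.-} {Sign.-} _ = refl

    isSign-refl : ∀ s → isSign F Γ s s ≡ true
    isSign-refl Sign.+ = refl
    isSign-refl Sign.- = refl

    -- The frustrated edges form a symmetric, loopless set of edges of Γ_S.
    frustrated-swap : ∀ S τ u v → frustrated S τ u v ≡ frustrated S τ v u
    frustrated-swap S τ u v rewrite adj-sym u v | σ-sym u v | *-comm (τ u) (τ v) =
      cong (adj v u ∧_) (∧-exchange (lookup S u) (lookup S v) _)

    frustrated-loopless : ∀ S τ u → frustrated S τ u u ≡ false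
    frustrated-loopless S τ u rewrite adj-irr u = refl

    frustrated-deletable : ∀ S τ → Deletable F Γ S (frustrated S τ)
    frustrated-deletable S τ = frustrated-swap S τ , λ u v fr →
      let (a , su , sv , _) = ∧₄-true (adj u v) (lookup S u) (lookup S v) fr in a , su , sv

    -- A frustrated edge really violates σ(uv) = τ(u)τ(v).
    frustrated-violates : ∀ S τ {u v} → frustrated S τ u v ≡ true → σ u v ≢ τ u · τ v
    frustrated-violates S τ {u} {v} fr eq
      with ∧₄-true (adj u v) (lookup S u) (lookup S v) fr
    ... | _ , _ , _ , unsatisfied rewrite eq | isSign-refl (τ u · τ v) with unsatisfied
    ... | ()

    -- Deleting the frustrated edges of τ leaves a graph with which τ is consistent.
    frustration-free : ∀ S τ → Consistent τ (remaining F Γ S (frustrated S τ))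
    frustration-free S τ u v kept =
      isSign-≡ (survivor (adj u v) (lookup S u) (lookup S v) (isSign F Γ (σ u v) (τ u · τ v)) kept)

    -- Every deletion D that balances Γ_S contains the frustrated edges of some switching
    -- (Harary's theorem applied to the remaining graph).
    balancing⇒contains-frustrated : ∀ S D → Deletable F Γ S D → Balanced F Γ (remaining F Γ S D) →
                                    ∃ λ τ → ∀ u v → frustrated S τ u v ≡ true → D u v ≡ true
    balancing⇒contains-frustrated S D (D-sym , _) balanced = τ , contained
      where
      R : Fin n → Fin n → Bool
      R = remaining F Γ S D
      R-sym : ∀ u v → R u v ≡ R v u
      R-sym u v rewrite adj-sym u v | D-sym u v = cong (adj v u ∧_) (∧-exchange (lookup S u) (lookup S v) _)
      R-irr : ∀ u → R u u ≡ false
      R-irr u rewrite adj-irr u = refl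
      open Harary R R-sym R-irr balanced using (harary)
      τ : Fin n → Sign
      τ = proj₁ harary
      contained : ∀ u v → frustrated S τ u v ≡ true → D u v ≡ true
      contained u v fr with D u v in d
      ... | true  = refl
      ... | false = ⊥-elim (frustrated-violates S τ fr (proj₂ harary u v kept))
        where
        kept : R u v ≡ true
        kept with ∧₄-true (adj u v) (lookup S u) (lookup S v) fr
        ... | a , su , sv , _ rewrite a | su | sv | d = refl

    -- Weights are nonnegative (positive on edges, zero elsewhere).
    w-nonneg : ∀ u v → 0# ≤ w u v
    w-nonneg u v with adj u v in e
    ... | true  = proj₁ (w-pos u v e)
    ... | false = ≤-reflexive (≈-sym (w-zero u v e))

    -- Deleting more edges costs more.
    edgeWeight-mono : ∀ {D D'} → (∀ u v → D' u v ≡ true → D u v ≡ true) → edgeWeight F Γ D' ≤ edgeWeight F Γ D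
    edgeWeight-mono D'⊆D = ∑-mono λ u → ∑-mono λ v →
      ⟦⟧-mono _ _ (λ e → let (u<v , d') = ∧-true _ e in cong₂ _∧_ u<v (D'⊆D u v d')) (w-nonneg u v)

    -- The cost depends only on the values of the switching.
    cost-cong : ∀ S {τ τ'} → (∀ u → τ u ≡ τ' u) → cost S τ ≈ cost S τ'
    cost-cong S {τ} {τ'} τ≗τ' = ∑-cong λ u → ∑-cong λ v → ≈-reflexive (cong (λ b → ⟦ (toℕ u ℕ.<ᵇ toℕ v) ∧ b ⟧· w u v)
      (cong₂ (λ x y → adj u v ∧ lookup S u ∧ lookup S v ∧ not (isSign F Γ (σ u v) (x · y))) (τ≗τ' u) (τ≗τ' v)))

    -- The least cost of a switching on S is a value of e^σ_min(S).
    emin-exists : ∀ S → ∃ (IsEmin F Γ S)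
    emin-exists S = cost S τ₀ , attained , least
      where
      cheapest : ∃ λ τ₀ → ∀ τ → cost S τ₀ ≤ cost S τ
      cheapest = argmin-switching n (cost S) (cost-cong S)
      τ₀ : Fin n → Sign
      τ₀ = proj₁ cheapest
      attained : ∃ λ D → Deletable F Γ S D × Balanced F Γ (remaining F Γ S D) × (edgeWeight F Γ D ≈ cost S τ₀)
      attained = frustrated S τ₀ , frustrated-deletable S τ₀ , consistent⇒balanced {τ₀} (frustration-free S τ₀) , ≈-refl
      least : ∀ D → Deletable F Γ S D → Balanced F Γ (remaining F Γ S D) → cost S τ₀ ≤ edgeWeight F Γ D
      least D deletable balanced with balancing⇒contains-frustrated S D deletable balanced
      ... | τ , contained = ≤-trans (proj₂ cheapest τ) (edgeWeight-mono contained)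

    -- Every value of e^σ_min(S) is at most the cost of any switching ...
    emin≤cost : ∀ S {e} → IsEmin F Γ S e → ∀ τ → e ≤ cost S τ
    emin≤cost S (_ , least) τ =
      least (frustrated S τ) (frustrated-deletable S τ) (consistent⇒balanced {τ} (frustration-free S τ))

    -- ... and at least the cost of some switching.
    cost≤emin : ∀ S {e} → IsEmin F Γ S e → ∃ λ τ → cost S τ ≤ e
    cost≤emin S ((D , deletable , balanced , D≈e) , _) with balancing⇒contains-frustrated S D deletable balanced
    ... | τ , contained = τ , ≤-respʳ-≈ D≈e (edgeWeight-mono contained)

    -- The two sides of S under τ: its vertices of sign + and of sign -.
    positiveSide negativeSide : Subset n → (Fin n → Sign) → Subset n
    positiveSide S τ = tabulate λ u → lookup S u ∧ isSign F Γ Sign.+ (τ u)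
    negativeSide S τ = tabulate λ u → lookup S u ∧ isSign F Γ Sign.- (τ u)

    -- Membership in the sides.
    lookup-positiveSide : ∀ S τ u → lookup (positiveSide S τ) u ≡ (lookup S u ∧ isSign F Γ Sign.+ (τ u))
    lookup-positiveSide S τ = lookup∘tabulate _

    lookup-negativeSide : ∀ S τ u → lookup (negativeSide S τ) u ≡ (lookup S u ∧ isSign F Γ Sign.- (τ u))
    lookup-negativeSide S τ = lookup∘tabulate _

    -- Subsets with the same members are equal.
    subset-ext : ∀ {V W : Subset n} → (∀ u → lookup V u ≡ lookup W u) → V ≡ W
    subset-ext {V} {W} V≗W = trans (sym (tabulate∘lookup V)) (trans (tabulate-cong V≗W) (tabulate∘lookup W))

    -- The sides of τ partition S.
    sides-cover : ∀ S τ → positiveSide S τ ∪ negativeSide S τ ≡ S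
    sides-cover S τ = subset-ext λ u → begin
      lookup (positiveSide S τ ∪ negativeSide S τ) u
        ≡⟨ lookup-zipWith _∨_ u (positiveSide S τ) (negativeSide S τ) ⟩
      lookup (positiveSide S τ) u ∨ lookup (negativeSide S τ) u
        ≡⟨ cong₂ _∨_ (lookup-positiveSide S τ u) (lookup-negativeSide S τ u) ⟩
      (lookup S u ∧ isSign F Γ Sign.+ (τ u)) ∨ (lookup S u ∧ isSign F Γ Sign.- (τ u))
        ≡⟨ one-of-two (lookup S u) (τ u) ⟩
      lookup S u ∎
      where
      open ≡-Reasoning
      one-of-two : ∀ b s → ((b ∧ isSign F Γ Sign.+ s) ∨ (b ∧ isSign F Γ Sign.- s)) ≡ b
      one-of-two true  Sign.+ = refl
      one-of-two true  Sign.- = refl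
      one-of-two false s      = refl

    sides-disjoint : ∀ S τ → Disjoint F Γ (positiveSide S τ) (negativeSide S τ)
    sides-disjoint S τ u =
      trans (cong₂ _∧_ (lookup-positiveSide S τ u) (lookup-negativeSide S τ u)) (not-both (lookup S u) (τ u))
      where
      not-both : ∀ b s → ((b ∧ isSign F Γ Sign.+ s) ∧ (b ∧ isSign F Γ Sign.- s)) ≡ false
      not-both true  Sign.+ = refl
      not-both true  Sign.- = refl
      not-both false s      = refl

    -- The switching that is + exactly on V₁.
    switchingOf : Subset n → Fin n → Sign
    switchingOf V₁ u = if lookup V₁ u then Sign.+ else Sign.-

    -- Every disjoint pair (V₁, V₂) is the pair of sides of switchingOf V₁ on V₁ ∪ V₂.
    sides-of-pair : ∀ V₁ V₂ → Disjoint F Γ V₁ V₂ →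
                    positiveSide (V₁ ∪ V₂) (switchingOf V₁) ≡ V₁ × negativeSide (V₁ ∪ V₂) (switchingOf V₁) ≡ V₂
    sides-of-pair V₁ V₂ disjoint =
      subset-ext (λ u → trans (lookup-positiveSide (V₁ ∪ V₂) (switchingOf V₁) u)
                              (trans (cong (_∧ _) (lookup-zipWith _∨_ u V₁ V₂)) (first (lookup V₁ u) (lookup V₂ u)))) ,
      subset-ext (λ u → trans (lookup-negativeSide (V₁ ∪ V₂) (switchingOf V₁) u)
                              (trans (cong (_∧ _) (lookup-zipWith _∨_ u V₁ V₂)) (second (lookup V₁ u) (lookup V₂ u) (disjoint u))))
      where
      first : ∀ x y → ((x ∨ y) ∧ isSign F Γ Sign.+ (if x then Sign.+ else Sign.-)) ≡ x
      first true  y = refl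
      first false y = ∧-zeroʳ y
      second : ∀ x y → (x ∧ y) ≡ false → ((x ∨ y) ∧ isSign F Γ Sign.- (if x then Sign.+ else Sign.-)) ≡ y
      second true  false _ = refl
      second false y     _ = ∧-identityʳ y

    -- The summand of Es s V₁ V₂ at the ordered pair (u, v).
    EsTerm : Sign → Subset n → Subset n → Fin n → Fin n → Carrier
    EsTerm s V₁ V₂ u v = ⟦ lookup V₁ u ∧ lookup V₂ v ∧ isSign F Γ s (σ u v) ⟧· w u v

    -- Es is symmetric in its two vertex sets.
    Es-transpose : ∀ s V₁ V₂ → Es F Γ s V₂ V₁ ≈ Es F Γ s V₁ V₂
    Es-transpose s V₁ V₂ = ≈-trans (≈-sym (∑∑-transpose (EsTerm s V₂ V₁))) (∑∑-cong swapped)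
      where
      swapped : ∀ u v → EsTerm s V₂ V₁ v u ≈ EsTerm s V₁ V₂ u v
      swapped u v rewrite σ-sym v u | ∧-exchange (lookup V₂ v) (lookup V₁ u) (isSign F Γ s (σ u v)) =
        ⟦⟧-cong _ (w-sym v u)

    -- Over ordered pairs, a symmetric loopless edge set is counted twice.
    ordered-pairs-double : ∀ D → (∀ u v → D u v ≡ D v u) → (∀ u → D u u ≡ false) →
                           ∑∑ (λ u v → ⟦ D u v ⟧· w u v) ≈ edgeWeight F Γ D + edgeWeight F Γ D
    ordered-pairs-double D D-sym D-irr =
      ≈-trans (∑∑-cong both-orders) (≈-trans (∑∑-+ once (λ u v → once v u)) (+-cong ≈-refl (∑∑-transpose once)))
      where
      once : Fin n → Fin n → Carrier
      once u v = ⟦ (toℕ u ℕ.<ᵇ toℕ v) ∧ D u v ⟧· w u v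
      <ᵇ-true : ∀ {i j} → i ℕ.< j → (i ℕ.<ᵇ j) ≡ true
      <ᵇ-true i<j = Equivalence.to T-≡ (ℕₚ.<⇒<ᵇ i<j)
      <ᵇ-false : ∀ {i j} → ¬ i ℕ.< j → (i ℕ.<ᵇ j) ≡ false
      <ᵇ-false {i} {j} i≮j = ¬-not (λ e → i≮j (ℕₚ.<ᵇ⇒< i j (Equivalence.from T-≡ e)))
      both-orders : ∀ u v → ⟦ D u v ⟧· w u v ≈ once u v + once v u
      both-orders u v with ℕₚ.<-cmp (toℕ u) (toℕ v)
      ... | tri< u<v _ v≮u rewrite <ᵇ-true u<v | <ᵇ-false v≮u = ≈-sym (+-identityʳ _)
      ... | tri> u≮v _ v<u rewrite <ᵇ-false u≮v | <ᵇ-true v<u | D-sym u v =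
            ≈-trans (⟦⟧-cong (D v u) (w-sym u v)) (≈-sym (+-identityˡ _))
      ... | tri≈ u≮v u≡v _ with toℕ-injective u≡v
      ...   | refl rewrite <ᵇ-false u≮v | D-irr u = ≈-sym (+-identityʳ 0#)

    -- Non-adjacent pairs carry weight 0, so the adjacency test may be dropped.
    adjacency-irrelevant : ∀ u v b → ⟦ adj u v ∧ b ⟧· w u v ≈ ⟦ b ⟧· w u v
    adjacency-irrelevant u v b with adj u v in e
    ... | true  = ≈-refl
    ... | false = ≈-sym (⟦⟧-zero b (w-zero u v e))

    -- Which term of the β-numerator counts an ordered pair (u, v) of vertices of S with
    -- signs s = τ u, t = τ v and edge sign r: a frustrated pair is counted exactly once.
    frustration-table : ∀ (su sv : Bool) (s t r : Sign) (x : Carrier) →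
      ⟦ su ∧ sv ∧ not (isSign F Γ r (s · t)) ⟧· x ≈
        ((⟦ (su ∧ isSign F Γ Sign.+ s) ∧ (sv ∧ isSign F Γ Sign.- t) ∧ isSign F Γ Sign.+ r ⟧· x
        + ⟦ (su ∧ isSign F Γ Sign.- s) ∧ (sv ∧ isSign F Γ Sign.+ t) ∧ isSign F Γ Sign.+ r ⟧· x)
        + ⟦ (su ∧ isSign F Γ Sign.+ s) ∧ (sv ∧ isSign F Γ Sign.+ t) ∧ isSign F Γ Sign.- r ⟧· x)
        + ⟦ (su ∧ isSign F Γ Sign.- s) ∧ (sv ∧ isSign F Γ Sign.- t) ∧ isSign F Γ Sign.- r ⟧· x
    frustration-table false sv    s      t      r      x = zero-of-four
    frustration-table true  false Sign.+ t      r      x = zero-of-four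
    frustration-table true  false Sign.- t      r      x = zero-of-four
    frustration-table true  true  Sign.+ Sign.+ Sign.+ x = zero-of-four
    frustration-table true  true  Sign.+ Sign.+ Sign.- x = third-of-four x
    frustration-table true  true  Sign.+ Sign.- Sign.+ x = first-of-four x
    frustration-table true  true  Sign.+ Sign.- Sign.- x = zero-of-four
    frustration-table true  true  Sign.- Sign.+ Sign.+ x = second-of-four x
    frustration-table true  true  Sign.- Sign.+ Sign.- x = zero-of-four
    frustration-table true  true  Sign.- Sign.- Sign.+ x = zero-of-four
    frustration-table true  true  Sign.- Sign.- Sign.- x = fourth-of-four x

    -- The frustrated pairs of τ split into the four β-terms of its sides.
    frustrated-pairs-split : ∀ S τ →
      let P = positiveSide S τ ; N = negativeSide S τ in
      ∑∑ (λ u v → ⟦ frustrated S τ u v ⟧· w u v) ≈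
        ((Es F Γ Sign.+ P N + Es F Γ Sign.+ N P) + Es F Γ Sign.- P P) + Es F Γ Sign.- N N
    frustrated-pairs-split S τ =
      ≈-trans (∑∑-cong pointwise)
              (≈-trans (∑∑-+ _ (EsTerm Sign.- N N))
                       (+-cong (≈-trans (∑∑-+ _ (EsTerm Sign.- P P)) (+-cong (∑∑-+ (EsTerm Sign.+ P N) (EsTerm Sign.+ N P)) ≈-refl)) ≈-refl))
      where
      P N : Subset n
      P = positiveSide S τ
      N = negativeSide S τ
      pointwise : ∀ u v → ⟦ frustrated S τ u v ⟧· w u v ≈
        ((EsTerm Sign.+ P N u v + EsTerm Sign.+ N P u v) + EsTerm Sign.- P P u v) + EsTerm Sign.- N N u v
      pointwise u v
        rewrite lookup-positiveSide S τ u | lookup-positiveSide S τ v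
              | lookup-negativeSide S τ u | lookup-negativeSide S τ v
        = ≈-trans (adjacency-irrelevant u v _)
                  (frustration-table (lookup S u) (lookup S v) (τ u) (τ v) (σ u v) (w u v))

    -- The boundary weight |E(S, S̄)|.
    cut : Subset n → Carrier
    cut S = Ew F Γ S (∁ S)

    -- The β-numerator of the sides of τ is twice its cost plus the boundary of S.
    β-sides : ∀ S τ → βnum F Γ (positiveSide S τ) (negativeSide S τ) ≈ (cost S τ + cost S τ) + cut S
    β-sides S τ = +-cong frustrated-part boundary-part
      where
      P N : Subset n
      P = positiveSide S τ
      N = negativeSide S τ
      open SetoidReasoning setoid
      frustrated-part : ((Es F Γ Sign.+ P N + Es F Γ Sign.+ P N) + Es F Γ Sign.- P P) + Es F Γ Sign.- N N
                        ≈ cost S τ + cost S τ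
      frustrated-part = begin
        ((Es F Γ Sign.+ P N + Es F Γ Sign.+ P N) + Es F Γ Sign.- P P) + Es F Γ Sign.- N N
          ≈⟨ +-cong (+-cong (+-cong ≈-refl (≈-sym (Es-transpose Sign.+ P N))) ≈-refl) ≈-refl ⟩
        ((Es F Γ Sign.+ P N + Es F Γ Sign.+ N P) + Es F Γ Sign.- P P) + Es F Γ Sign.- N N
          ≈⟨ ≈-sym (frustrated-pairs-split S τ) ⟩
        ∑∑ (λ u v → ⟦ frustrated S τ u v ⟧· w u v)
          ≈⟨ ordered-pairs-double (frustrated S τ) (frustrated-swap S τ) (frustrated-loopless S τ) ⟩
        cost S τ + cost S τ ∎
      boundary-part : cut (P ∪ N) ≈ cut S
      boundary-part = ≈-reflexive (cong cut (sides-cover S τ))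

    -- For a disjoint pair, β is the β of the sides of its own switching.
    β-pair : ∀ V₁ V₂ → Disjoint F Γ V₁ V₂ →
             βnum F Γ V₁ V₂ ≈ (cost (V₁ ∪ V₂) (switchingOf V₁) + cost (V₁ ∪ V₂) (switchingOf V₁))
                               + cut (V₁ ∪ V₂)
    β-pair V₁ V₂ disjoint with sides-of-pair V₁ V₂ disjoint
    ... | P≡V₁ , N≡V₂ = subst₂ (λ X Y → βnum F Γ X Y ≈ twice-cost+boundary) P≡V₁ N≡V₂ (β-sides (V₁ ∪ V₂) (switchingOf V₁))
      where
      twice-cost+boundary : Carrier
      twice-cost+boundary = (cost (V₁ ∪ V₂) (switchingOf V₁) + cost (V₁ ∪ V₂) (switchingOf V₁))
                            + cut (V₁ ∪ V₂)

    -- A disjoint pair has β-numerator at least 2e + |E(S, S̄)| for S = V₁ ∪ V₂ and any value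
    -- e of e^σ_min(S): its own switching costs at least e.
    pair-bound : ∀ V₁ V₂ e → Disjoint F Γ V₁ V₂ → IsEmin F Γ (V₁ ∪ V₂) e →
                 ((e + e) + cut (V₁ ∪ V₂)) ≤ βnum F Γ V₁ V₂
    pair-bound V₁ V₂ e disjoint emin =
      ≤-respʳ-≈ (≈-sym (β-pair V₁ V₂ disjoint)) (double-mono _ (emin≤cost (V₁ ∪ V₂) emin (switchingOf V₁)))

    -- Some pair of sides of S has β-numerator at most 2e + |E(S, S̄)|: a switching attaining e.
    sides-bound : ∀ S e → IsEmin F Γ S e →
                  ∃ λ τ → βnum F Γ (positiveSide S τ) (negativeSide S τ) ≤ ((e + e) + cut S)
    sides-bound S e emin with cost≤emin S emin
    ... | τ , cost≤e = τ , ≤-respˡ-≈ (≈-sym (β-sides S τ)) (double-mono _ cost≤e)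

    module _ (μ : Fin n → Carrier) (m : Carrier) where
      open OrderedField F using (_*_)

      -- m is a lower bound for β: m·vol(V₁ ∪ V₂) ≤ β-numerator on all admissible pairs.
      BoundsBeta : Set
      BoundsBeta = ∀ V₁ V₂ → Disjoint F Γ V₁ V₂ → NonEmpty F Γ (V₁ ∪ V₂) →
                   (m * vol F Γ μ (V₁ ∪ V₂)) ≤ βnum F Γ V₁ V₂

      -- m is a lower bound for the right-hand quotient.
      BoundsRHS : Set
      BoundsRHS = ∀ S e → NonEmpty F Γ S → IsEmin F Γ S e → (m * vol F Γ μ S) ≤ ((e + e) + cut S)

      -- The sides of S have the volume of S.
      vol-sides : ∀ S τ → (m * vol F Γ μ (positiveSide S τ ∪ negativeSide S τ)) ≈ (m * vol F Γ μ S)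
      vol-sides S τ = ≈-reflexive (cong (λ Z → m * vol F Γ μ Z) (sides-cover S τ))

      -- A lower bound for β applies in particular to the sides of a switching of S.
      sides-lower : BoundsBeta → ∀ S τ → NonEmpty F Γ S →
                    (m * vol F Γ μ S) ≤ βnum F Γ (positiveSide S τ) (negativeSide S τ)
      sides-lower lower S τ nonempty =
        ≤-respˡ-≈ (vol-sides S τ)
                  (lower (positiveSide S τ) (negativeSide S τ) (sides-disjoint S τ) (subst (NonEmpty F Γ) (sym (sides-cover S τ)) nonempty))

      -- A lower bound for β bounds 2e + cut through the sides of a switching attaining e.
      beta-bound⇒rhs-bound : BoundsBeta → BoundsRHS
      beta-bound⇒rhs-bound lower S e nonempty emin with sides-bound S e emin
      ... | τ , sides≤ = ≤-trans (sides-lower lower S τ nonempty) sides≤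

      -- A lower bound for the right-hand quotient bounds β through pair-bound.
      rhs-bound⇒beta-bound : BoundsRHS → BoundsBeta
      rhs-bound⇒beta-bound lower V₁ V₂ disjoint nonempty with emin-exists (V₁ ∪ V₂)
      ... | e , emin = ≤-trans (lower (V₁ ∪ V₂) e nonempty emin) (pair-bound V₁ V₂ e disjoint emin)

      -- The minimum of β is attained at (V₁, V₂); the right-hand minimum is attained at V₁ ∪ V₂.
      h1⇒rhs : IsH1 F Γ μ m → IsRHS F Γ μ m
      h1⇒rhs ((V₁ , V₂ , disjoint , nonempty , attained) , lower) with emin-exists (V₁ ∪ V₂)
      ... | e , emin = (V₁ ∪ V₂ , e , nonempty , emin , ≤-antisym (rhs-lower (V₁ ∪ V₂) e nonempty emin) β≤) , rhs-lower
        where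
        rhs-lower : BoundsRHS
        rhs-lower = beta-bound⇒rhs-bound lower
        β≤ : ((e + e) + cut (V₁ ∪ V₂)) ≤ (m * vol F Γ μ (V₁ ∪ V₂))
        β≤ = ≤-respʳ-≈ (≈-sym attained) (pair-bound V₁ V₂ e disjoint emin)

      -- The right-hand minimum is attained at S; β is minimal at the sides of a cheapest switching.
      rhs⇒h1 : IsRHS F Γ μ m → IsH1 F Γ μ m
      rhs⇒h1 ((S , e , nonempty , emin , attained) , lower) with sides-bound S e emin
      ... | τ , sides≤ = (P , N , disjoint , nonempty′ , ≤-antisym (beta-lower P N disjoint nonempty′) ≤vol) , beta-lower
        where
        P N : Subset n
        P = positiveSide S τ
        N = negativeSide S τ
        disjoint : Disjoint F Γ P N
        disjoint = sides-disjoint S τ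
        nonempty′ : NonEmpty F Γ (P ∪ N)
        nonempty′ = subst (NonEmpty F Γ) (sym (sides-cover S τ)) nonempty
        beta-lower : BoundsBeta
        beta-lower = rhs-bound⇒beta-bound lower
        ≤vol : βnum F Γ P N ≤ (m * vol F Γ μ (P ∪ N))
        ≤vol = ≤-respʳ-≈ (≈-trans (≈-sym attained) (≈-sym (vol-sides S τ))) sides≤

corollary3p4 : (F : OrderedField) → (n : ℕ) → (Γ : SignedGraph F n)
    → (μ : Fin n → OrderedField.Carrier F) → (∀ u → OrderedField.Pos F (μ u))
    → (m : OrderedField.Carrier F) → IsH1 F Γ μ m ⇔ IsRHS F Γ μ m
corollary3p4 F n Γ μ _ m = mk⇔ (h1⇒rhs F Γ μ m) (rhs⇒h1 F Γ μ m)
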